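{- Let $q=3^d$ with $d$ even, let $\beta$ be a fixed primitive root of $\mathbb{F}_q^\times$ (a generator of the multiplicative group), and let $\alpha\in\mathbb{F}_q$ be a fixed element with $\operatorname{Tr}(\alpha)=1$. Let $E\colon y^2=x^3+a_4x+a_6$ be an elliptic curve over $\mathbb{F}_q$ of Type II, i.e. such that $-a_4\in\mathbb{F}_q^\times$ is a square but not a fourth power in $\mathbb{F}_q^\times$. Then there exists $u\in\mathbb{F}_q^\times$ with $u^4=\beta^2(-a_4)^{ -1}$, and $E$ is isomorphic over $\mathbb{F}_q$ to $E_b\colon y^2=x^3-\beta^2x+b$ with $b=u^6a_6$; every elliptic curve $y^2=x^3+a_4'x+a_6'$ isomorphic to $E$ over $\mathbb{F}_q$ is also of Type II. Moreover, the curves $E_b\colon y^2=x^3-\beta^2x+b$, $b\in\mathbb{F}_q$, form exactly two $\mathbb{F}_q$-isomorphism classes: (i) if $\operatorname{Tr}(b\beta^{ -3})=0$, then $E_b$ is isomorphic to $E_0$; (ii) if $\operatorname{Tr}(b\beta^{ -3})\neq0$, then $E_b$ is isomorphic to $E_{\alpha\beta^3}$.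
   Context: $\operatorname{Tr}$ denotes the trace map $\mathbb{F}_q\to\mathbb{F}_3$. In characteristic $3$, every supersingular elliptic curve over $\mathbb{F}_q$ can be written as $y^2=x^3+a_4x+a_6$ with $a_4\neq0$. -}

module Defs where

open import Algebra.Bundles using (CommutativeRing)
import Algebra.Properties.CommutativeMonoid.Sum as Sum
import Algebra.Properties.Monoid.Mult as Mult
import Algebra.Properties.Semiring.Exp as Exp
open import Data.Fin.Base using (Fin; toℕ)
open import Data.Nat.Base as ℕ using (ℕ)
open import Data.Product.Base using (_×_; ∃-syntax; proj₁)
open import Data.Sum.Base using (_⊎_)
open import Function.Bundles using (Inverse)
open import Level using (Level; _⊔_; suc)
open import Relation.Binary.Core using (Rel)
import Relation.Binary.PropositionalEquality.Properties as ≡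
open import Relation.Nullary.Negation.Core using (¬_)

record FiniteField (c ℓ : Level) (q : ℕ) : Set (suc (c ⊔ ℓ)) where
  field
    commutativeRing : CommutativeRing c ℓ

  open CommutativeRing commutativeRing public

  field
    1≉0         : 1# ≉ 0#
    inverse     : ∀ {x} → x ≉ 0# → ∃[ y ] x * y ≈ 1#
    enumeration : Inverse (≡.setoid (Fin q)) setoid

  open Exp semiring public using (_^_)
  open Mult +-monoid public using () renaming (_×_ to _·_)

  inv : ∀ {x} → x ≉ 0# → Carrier
  inv x≉0 = proj₁ (inverse x≉0)

  record IsPrimitiveRoot (β : Carrier) : Set (c ⊔ ℓ) where
    field
      nonZero   : β ≉ 0#
      generates : ∀ x → x ≉ 0# → ∃[ n ] β ^ n ≈ x

  IsUnitPower : ℕ → Carrier → Set (c ⊔ ℓ)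
  IsUnitPower n x = ∃[ v ] (v ≉ 0# × v ^ n ≈ x)

-- The trace 𝔽_q → 𝔽₃ for q = 3^d, as the sum of the Galois conjugates of x.
-- Its values are taken in the prime subfield 𝔽₃ ⊆ 𝔽_q.
module Trace {c ℓ : Level} (d : ℕ) (F : FiniteField c ℓ (3 ℕ.^ d)) where
  open FiniteField F

  Tr : Carrier → Carrier
  Tr x = Sum.sum +-commutativeMonoid {d} (λ i → x ^ (3 ℕ.^ toℕ i))

module Curves {c ℓ : Level} {q : ℕ} (F : FiniteField c ℓ q) where
  open FiniteField F

  -- y² + a₁xy + a₃y = x³ + a₂x² + a₄x + a₆
  record WeierstrassCurve : Set c where
    constructor weierstrass
    field
      a₁ a₂ a₃ a₄ a₆ : Carrier

    b₂ b₄ b₆ b₈ Δ : Carrier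
    b₂ = a₁ ^ 2 + 4 · a₂
    b₄ = 2 · a₄ + a₁ * a₃
    b₆ = a₃ ^ 2 + 4 · a₆
    b₈ = a₁ ^ 2 * a₆ + 4 · (a₂ * a₆) - a₁ * a₃ * a₄ + a₂ * a₃ ^ 2 - a₄ ^ 2
    Δ  = 9 · (b₂ * b₄ * b₆) - b₂ ^ 2 * b₈ - 8 · (b₄ ^ 3) - 27 · (b₆ ^ 2)

  IsElliptic : WeierstrassCurve → Set ℓ
  IsElliptic W = WeierstrassCurve.Δ W ≉ 0#

  -- The admissible change of variables over the base field
  --   x = u²x′ + r,   y = u³y′ + u²sx′ + t,   u ≠ 0,
  -- turns the equation of W into u⁶ times that of W′. The last five fields
  -- compare coefficients.
  record _≅_ (W W′ : WeierstrassCurve) : Set (c ⊔ ℓ) where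
    private
      module W  = WeierstrassCurve W
      module W′ = WeierstrassCurve W′
    field
      u r s t : Carrier
      u≉0     : u ≉ 0#
      a₁-eq   : u * W′.a₁ ≈ W.a₁ + 2 · s
      a₂-eq   : u ^ 2 * W′.a₂ ≈ W.a₂ - s * W.a₁ + 3 · r - s ^ 2
      a₃-eq   : u ^ 3 * W′.a₃ ≈ W.a₃ + r * W.a₁ + 2 · t
      a₄-eq   : u ^ 4 * W′.a₄ ≈
                W.a₄ - s * W.a₃ + 2 · (r * W.a₂) - (t + r * s) * W.a₁
                  + 3 · (r ^ 2) - 2 · (s * t)
      a₆-eq   : u ^ 6 * W′.a₆ ≈
                W.a₆ + r * W.a₄ + r ^ 2 * W.a₂ + r ^ 3
                  - t * W.a₃ - t ^ 2 - r * t * W.a₁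

  infix 4 _≅_

  -- y² = x³ + a₄x + a₆
  short : Carrier → Carrier → WeierstrassCurve
  short a₄ a₆ = weierstrass 0# 0# 0# a₄ a₆

  -- Type II of the curve y² = x³ + a₄x + a₆; it does not involve a₆.
  record IsTypeII (a₄ : Carrier) : Set (c ⊔ ℓ) where
    field
      nonZero        : - a₄ ≉ 0#
      square         : IsUnitPower 2 (- a₄)
      notFourthPower : ¬ IsUnitPower 4 (- a₄)

-- The family E meets exactly two classes of the equivalence relation _∼_.
ExactlyTwoClasses : {a b ℓ : Level} {I : Set a} {A : Set b} →
                    Rel A ℓ → (I → A) → Set (a ⊔ ℓ)
ExactlyTwoClasses _∼_ E =
  ∃[ i ] ∃[ j ] (¬ (E i ∼ E j) × (∀ k → E k ∼ E i ⊎ E k ∼ E j))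

{-# OPTIONS --safe #-}

-- Isomorphisms between short Weierstrass curves in characteristic 3 are the
-- substitutions x = u²x′ + r, y = u³y′.  Between E_b and E_b′ such a
-- substitution exists iff, for some u with u⁴ = 1 and some ρ,
-- u²·b′β⁻³ = bβ⁻³ + ρ³ − ρ.  By additive Hilbert 90 the elements ρ³ − ρ are
-- those of trace zero, which separates the classes; the traces 1 and −1 are
-- identified by u² = −1, which is solvable because 4 ∣ 3^d − 1 for even d.
module Submission where

open import Defs
open import Algebra.Bundles using (CommutativeRing; RawRing)
open import Algebra.Solver.Ring.AlmostCommutativeRing
  using (fromCommutativeRing; _-Raw-AlmostCommutative⟶_)
import Algebra.Properties.CommutativeSemiring.Exp as CommutativeExp
import Algebra.Properties.Ring as RingProperties
import Algebra.Properties.Semiring.Exp as Exp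
import Algebra.Properties.Semiring.Mult as Mult
import Algebra.Properties.Semiring.Sum as Sum
import Algebra.Solver.Ring as Solver
open import Data.Empty using (⊥-elim)
open import Data.Fin.Base as Fin using (Fin; toℕ)
open import Data.Fin.Patterns using (0F; 1F)
import Data.Fin.Permutation as Perm
import Data.Fin.Properties as Fin
open import Data.Maybe.Base using (Maybe; just; nothing)
open import Data.Nat.Base as ℕ using (ℕ; zero; suc; s≤s; _≤_; _<_)
open import Data.Nat.Divisibility using (_∣_; divides)
open import Data.Nat.DivMod using (_%_; _/_; _mod_; _divMod_; result; m≡m%n+[m/n]*n; m%n<n)
import Data.Nat.Properties as ℕ
open import Data.Nat.Tactic.RingSolver using (solve-∀)
open import Data.Product.Base using (_×_; _,_; ∃-syntax; proj₁; proj₂)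
open import Data.Sum.Base using (_⊎_; inj₁; inj₂; [_,_]′)
open import Data.Vec.Functional using (replicate)
open import Function.Base using (_∘_; id)
open import Function.Bundles using (Inverse)
open import Level using (_⊔_)
open import Relation.Binary.Definitions using (Decidable)
open import Relation.Binary.PropositionalEquality as ≡ using (_≡_)
import Relation.Binary.Reasoning.Setoid as SetoidReasoning
open import Relation.Nullary using (¬_; Dec; yes; no)
open import Relation.Nullary.Decidable using (map′)

-- Coefficient arithmetic for the ring solver in characteristic 3.

data 𝔽₃ : Set where
  0₃ 1₃ -1₃ : 𝔽₃

infixl 6 _+₃_
infixl 7 _*₃_

_+₃_ : 𝔽₃ → 𝔽₃ → 𝔽₃
0₃  +₃ y   = y
1₃  +₃ 0₃  = 1₃
1₃  +₃ 1₃  = -1₃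
1₃  +₃ -1₃ = 0₃
-1₃ +₃ 0₃  = -1₃
-1₃ +₃ 1₃  = 0₃
-1₃ +₃ -1₃ = 1₃

-₃_ : 𝔽₃ → 𝔽₃
-₃ 0₃  = 0₃
-₃ 1₃  = -1₃
-₃ -1₃ = 1₃

_*₃_ : 𝔽₃ → 𝔽₃ → 𝔽₃
0₃  *₃ y = 0₃
1₃  *₃ y = y
-1₃ *₃ y = -₃ y

𝔽₃-rawRing : RawRing _ _
𝔽₃-rawRing = record
  { Carrier = 𝔽₃ ; _≈_ = _≡_ ; _+_ = _+₃_ ; _*_ = _*₃_ ; -_ = -₃_ ; 0# = 0₃ ; 1# = 1₃ }

module _ {c ℓ} (R : CommutativeRing c ℓ) where
  open CommutativeRing R

  -- Taking coefficients in 𝔽₃ lets the ring solver decide identities that hold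
  -- only in characteristic 3.
  module CharacteristicThree (1+1+1≈0 : 1# + (1# + 1#) ≈ 0#) where

    open RingProperties ring
      using (-0#≈0#; -‿involutive; -1*x≈-x; +-inverseʳ-unique; +-inverseˡ-unique)

    private
      1+1≈-1 : 1# + 1# ≈ - 1#
      1+1≈-1 = +-inverseʳ-unique _ _ 1+1+1≈0

      ⟦_⟧₃ : 𝔽₃ → Carrier
      ⟦ 0₃  ⟧₃ = 0#
      ⟦ 1₃  ⟧₃ = 1#
      ⟦ -1₃ ⟧₃ = - 1#

      ⟦⟧₃-+ : ∀ x y → ⟦ x +₃ y ⟧₃ ≈ ⟦ x ⟧₃ + ⟦ y ⟧₃
      ⟦⟧₃-+ 0₃  y   = sym (+-identityˡ _)
      ⟦⟧₃-+ 1₃  0₃  = sym (+-identityʳ _)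
      ⟦⟧₃-+ 1₃  1₃  = sym 1+1≈-1
      ⟦⟧₃-+ 1₃  -1₃ = sym (-‿inverseʳ _)
      ⟦⟧₃-+ -1₃ 0₃  = sym (+-identityʳ _)
      ⟦⟧₃-+ -1₃ 1₃  = sym (-‿inverseˡ _)
      ⟦⟧₃-+ -1₃ -1₃ = begin
        1#             ≈⟨ +-inverseˡ-unique _ _ 1+1+1≈0 ⟩
        - (1# + 1#)    ≈⟨ -‿cong 1+1≈-1 ⟩
        - (- 1#)       ≈⟨ -‿involutive _ ⟩
        1#             ≈⟨ +-identityʳ _ ⟨
        1# + 0#        ≈⟨ +-congˡ (-‿inverseʳ _) ⟨
        1# + (1# - 1#) ≈⟨ +-assoc _ _ _ ⟨
        1# + 1# - 1#   ≈⟨ +-congʳ 1+1≈-1 ⟩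
        - 1# - 1#      ∎
        where open SetoidReasoning setoid

      ⟦⟧₃-neg : ∀ x → ⟦ -₃ x ⟧₃ ≈ - ⟦ x ⟧₃
      ⟦⟧₃-neg 0₃  = sym -0#≈0#
      ⟦⟧₃-neg 1₃  = refl
      ⟦⟧₃-neg -1₃ = sym (-‿involutive _)

      ⟦⟧₃-* : ∀ x y → ⟦ x *₃ y ⟧₃ ≈ ⟦ x ⟧₃ * ⟦ y ⟧₃
      ⟦⟧₃-* 0₃  y = sym (zeroˡ _)
      ⟦⟧₃-* 1₃  y = sym (*-identityˡ _)
      ⟦⟧₃-* -1₃ y = trans (⟦⟧₃-neg y) (sym (-1*x≈-x _))

      morphism : 𝔽₃-rawRing -Raw-AlmostCommutative⟶ fromCommutativeRing R
      morphism = record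
        { ⟦_⟧ = ⟦_⟧₃ ; +-homo = ⟦⟧₃-+ ; *-homo = ⟦⟧₃-* ; -‿homo = ⟦⟧₃-neg
        ; 0-homo = refl ; 1-homo = refl }

      _≟₃_ : ∀ x y → Maybe (⟦ x ⟧₃ ≈ ⟦ y ⟧₃)
      0₃  ≟₃ 0₃  = just refl
      1₃  ≟₃ 1₃  = just refl
      -1₃ ≟₃ -1₃ = just refl
      _   ≟₃ _   = nothing

    open Solver 𝔽₃-rawRing (fromCommutativeRing R) morphism _≟₃_ public
      using (solve; _:=_; _:+_; _:*_; _:-_; :-_; _:^_; _:×_; con)

-- Finite fields: cancellation and counting.

module FiniteFieldProperties {c ℓ} {q : ℕ} (F : FiniteField c ℓ q) where
  open FiniteField F
  open Inverse enumeration
    using (to; from; to-cong; from-cong; strictlyInverseˡ; strictlyInverseʳ)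
  open RingProperties ring
    using (+-identityʳ-unique; x≈y⇒x∙y⁻¹≈ε; x∙y⁻¹≈ε⇒x≈y; +-inverseˡ-unique; x[y-z]≈xy-xz
          ; //-rightDividesˡ; //-rightDividesʳ)
  open Exp semiring using (^-congˡ; ^-congʳ; ^-homo-*; ^-assocʳ)
  open Sum semiring using (sum; sum-permute; sum-cong-≋; sum-replicate; ∑-distrib-+)
  open SetoidReasoning setoid

  from-injective : ∀ {x y} → from x ≡ from y → x ≈ y
  from-injective eq =
    trans (sym (strictlyInverseˡ _)) (trans (to-cong eq) (strictlyInverseˡ _))

  to-injective : ∀ {i j} → to i ≈ to j → i ≡ j
  to-injective eq =
    ≡.trans (≡.sym (strictlyInverseʳ _)) (≡.trans (from-cong eq) (strictlyInverseʳ _))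

  infix 4 _≟_

  -- Inherited from `Fin q` through the enumeration; it makes case splits on vanishing, such as that
  -- of a trace, constructive.
  _≟_ : Decidable _≈_
  x ≟ y = map′ from-injective from-cong (from x Fin.≟ from y)

  *-cancelˡ-≉0 : ∀ {x y z} → x ≉ 0# → x * y ≈ x * z → y ≈ z
  *-cancelˡ-≉0 {x} {y} {z} x≉0 eq = begin
    y               ≈⟨ recover y ⟨
    x⁻¹ * (x * y)   ≈⟨ *-congˡ eq ⟩
    x⁻¹ * (x * z)   ≈⟨ recover z ⟩
    z               ∎
    where
    x⁻¹ = inv x≉0
    recover : ∀ w → x⁻¹ * (x * w) ≈ w
    recover w = trans (sym (*-assoc _ _ _))
      (trans (*-congʳ (trans (*-comm _ _) (proj₂ (inverse x≉0)))) (*-identityˡ w))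

  x*y≈0⇒x≈0∨y≈0 : ∀ {x y} → x * y ≈ 0# → x ≈ 0# ⊎ y ≈ 0#
  x*y≈0⇒x≈0∨y≈0 {x} xy≈0 with x ≟ 0#
  ... | yes x≈0 = inj₁ x≈0
  ... | no  x≉0 = inj₂ (*-cancelˡ-≉0 x≉0 (trans xy≈0 (sym (zeroʳ x))))

  *-≉0 : ∀ {x y} → x ≉ 0# → y ≉ 0# → x * y ≉ 0#
  *-≉0 x≉0 y≉0 = [ x≉0 , y≉0 ]′ ∘ x*y≈0⇒x≈0∨y≈0

  ^-≉0 : ∀ {x} n → x ≉ 0# → x ^ n ≉ 0#
  ^-≉0 zero    x≉0 = 1≉0
  ^-≉0 (suc n) x≉0 = *-≉0 x≉0 (^-≉0 n x≉0)

  1^n≈1 : ∀ n → 1# ^ n ≈ 1#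
  1^n≈1 zero    = refl
  1^n≈1 (suc n) = trans (*-identityˡ _) (1^n≈1 n)

  inv-≉0 : ∀ {x} (x≉0 : x ≉ 0#) → inv x≉0 ≉ 0#
  inv-≉0 x≉0 x⁻¹≈0 =
    1≉0 (trans (sym (proj₂ (inverse x≉0))) (trans (*-congˡ x⁻¹≈0) (zeroʳ _)))

  x*x≈1⇒x≈±1 : ∀ {x} → x * x ≈ 1# → x ≈ 1# ⊎ x ≈ - 1#
  x*x≈1⇒x≈±1 {x} xx≈1
    with x*y≈0⇒x≈0∨y≈0 {x + 1#} {x - 1#} (begin
           (x + 1#) * (x - 1#)              ≈⟨ x[y-z]≈xy-xz _ _ _ ⟩
           (x + 1#) * x - (x + 1#) * 1#     ≈⟨ +-cong (distribʳ _ _ _) (-‿cong (*-identityʳ _)) ⟩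
           (x * x + 1# * x) - (x + 1#)      ≈⟨ +-congʳ (+-cong xx≈1 (*-identityˡ x)) ⟩
           (1# + x) - (x + 1#)              ≈⟨ x≈y⇒x∙y⁻¹≈ε (+-comm _ _) ⟩
           0#                               ∎)
  ... | inj₁ x+1≈0 = inj₂ (+-inverseˡ-unique _ _ x+1≈0)
  ... | inj₂ x-1≈0 = inj₁ (x∙y⁻¹≈ε⇒x≈y _ _ x-1≈0)

  -- Translation by 1 permutes the field, so it does not change the sum of all
  -- elements.
  q·1≈0 : q · 1# ≈ 0#
  q·1≈0 = +-identityʳ-unique (sum to) (q · 1#) (begin
    sum to + q · 1#                 ≈⟨ +-congˡ (sum-replicate q) ⟨
    sum to + sum (replicate q 1#)   ≈⟨ ∑-distrib-+ to _ ⟨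
    sum (λ i → to i + 1#)           ≈⟨ sum-cong-≋ {q} {λ i → to (next i)} (λ i → strictlyInverseˡ _) ⟨
    sum (λ i → to (next i))         ≈⟨ sum-permute to translation ⟨
    sum to                          ∎)
    where
    next previous : Fin q → Fin q
    next     i = from (to i + 1#)
    previous i = from (to i - 1#)
    translation : Perm.Permutation′ q
    translation = Perm.permutation next previous
      (λ i → to-injective (trans (strictlyInverseˡ _)
        (trans (+-congʳ (strictlyInverseˡ _)) (//-rightDividesˡ 1# (to i)))))
      (λ i → to-injective (trans (strictlyInverseˡ _)
        (trans (+-congʳ (strictlyInverseˡ _)) (//-rightDividesʳ 1# (to i)))))

  -- Choosing for each element an index that hits it is injective, since the index determines the
  -- element.
  covered⇒q≤ : ∀ {m} (f : Fin m → Carrier) → (∀ x → ∃[ k ] f k ≈ x) → q ≤ m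
  covered⇒q≤ f cover = Fin.injective⇒≤ {f = λ i → proj₁ (cover (to i))} λ {i} {j} eq →
    to-injective (trans (sym (proj₂ (cover (to i))))
      (trans (reflexive (≡.cong f eq)) (proj₂ (cover (to j)))))

  -- The order of a primitive root, and a square root of -1.

  module PrimitiveRoot {β : Carrier} (prim : IsPrimitiveRoot β) where
    open IsPrimitiveRoot prim

    -- One family serves two opposite counts: covering the field bounds `q` by the period plus one,
    -- and a collision yields a period below `q`.
    0∪powers : ∀ {m} → Fin (suc m) → Carrier
    0∪powers Fin.zero    = 0#
    0∪powers (Fin.suc k) = β ^ toℕ k

    ^-reduce : ∀ {p} → β ^ suc p ≈ 1# → ∀ n → β ^ (n % suc p) ≈ β ^ n
    ^-reduce {p} period n = sym (begin
      β ^ n                            ≈⟨ ^-congʳ β (m≡m%n+[m/n]*n n (suc p)) ⟩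
      β ^ (r ℕ.+ k ℕ.* suc p)          ≈⟨ ^-homo-* β r _ ⟩
      β ^ r * β ^ (k ℕ.* suc p)        ≈⟨ *-congˡ (^-congʳ β (ℕ.*-comm k (suc p))) ⟩
      β ^ r * β ^ (suc p ℕ.* k)        ≈⟨ *-congˡ (^-assocʳ β (suc p) k) ⟨
      β ^ r * (β ^ suc p) ^ k          ≈⟨ *-congˡ (trans (^-congˡ k period) (1^n≈1 k)) ⟩
      β ^ r * 1#                       ≈⟨ *-identityʳ _ ⟩
      β ^ r                            ∎)
      where
      r = n % suc p
      k = n / suc p

    -- Exponents reduce modulo the period, so 0 and `suc p` powers of β exhaust the field.
    period⇒q≤ : ∀ {p} → β ^ suc p ≈ 1# → q ≤ suc (suc p)
    period⇒q≤ {p} period = covered⇒q≤ 0∪powers cover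
      where
      cover : ∀ x → ∃[ k ] 0∪powers {suc p} k ≈ x
      cover x with x ≟ 0#
      ... | yes x≈0 = Fin.zero , sym x≈0
      ... | no  x≉0 with generates x x≉0
      ...   | n , βⁿ≈x = Fin.suc (n mod suc p) , (begin
        β ^ toℕ (n mod suc p)   ≈⟨ ^-congʳ β (Fin.toℕ-fromℕ< (m%n<n n (suc p))) ⟩
        β ^ (n % suc p)         ≈⟨ ^-reduce period n ⟩
        β ^ n                   ≈⟨ βⁿ≈x ⟩
        x                       ∎)

    -- Among the q + 1 values 0, β^0, ..., β^(q-1) two coincide. As 0 is no power of β, they are two
    -- powers, and the difference of their exponents is a period.
    period<q : ∃[ p ] (β ^ suc p ≈ 1# × suc p < q)
    period<q with Fin.pigeonhole (ℕ.n<1+n q) (from ∘ 0∪powers)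
    ... | Fin.zero  , Fin.suc j , _       , eq =
      ⊥-elim (^-≉0 (toℕ j) nonZero (sym (from-injective eq)))
    ... | Fin.suc i , Fin.suc j , s≤s i<j , eq =
      p , *-cancelˡ-≉0 (^-≉0 m nonZero) (begin
        β ^ m * β ^ suc p    ≈⟨ ^-homo-* β m (suc p) ⟨
        β ^ (m ℕ.+ suc p)    ≈⟨ ^-congʳ β m+1+p≡n ⟩
        β ^ toℕ j            ≈⟨ from-injective eq ⟨
        β ^ m                ≈⟨ *-identityʳ _ ⟨
        β ^ m * 1#           ∎)
      , ℕ.≤-<-trans (ℕ.≤-trans (ℕ.m≤n+m (suc p) m) (ℕ.≤-reflexive m+1+p≡n)) (Fin.toℕ<n j)
      where
      m = toℕ i
      p = toℕ j ℕ.∸ suc m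
      m+1+p≡n : m ℕ.+ suc p ≡ toℕ j
      m+1+p≡n = ≡.trans (ℕ.+-suc m p) (ℕ.m+[n∸m]≡n i<j)

    order : ∃[ p ] (β ^ suc p ≈ 1# × q ≡ suc (suc p))
    order with period<q
    ... | p , period , p<q = p , period , ℕ.≤-antisym (period⇒q≤ period) p<q

    -- A nonzero x is some β^n, and β^(q-1) = 1 by `order`, so x^(q-1) = 1.
    x^q≈x : ∀ x → x ^ q ≈ x
    x^q≈x x with order
    ... | p , period , ≡.refl with x ≟ 0#
    ...   | yes x≈0 = trans (*-congʳ x≈0) (trans (zeroˡ _) (sym x≈0))
    ...   | no  x≉0 with generates x x≉0
    ...     | n , βⁿ≈x = begin
      x * x ^ suc p            ≈⟨ *-congˡ (^-congˡ (suc p) βⁿ≈x) ⟨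
      x * (β ^ n) ^ suc p      ≈⟨ *-congˡ (^-assocʳ β n (suc p)) ⟩
      x * β ^ (n ℕ.* suc p)    ≈⟨ *-congˡ (^-congʳ β (ℕ.*-comm n (suc p))) ⟩
      x * β ^ (suc p ℕ.* n)    ≈⟨ *-congˡ (^-assocʳ β (suc p) n) ⟨
      x * (β ^ suc p) ^ n      ≈⟨ *-congˡ (trans (^-congˡ n period) (1^n≈1 n)) ⟩
      x * 1#                   ≈⟨ *-identityʳ x ⟩
      x                        ∎

    -- With q - 1 = 4m, the square of β^m squares to 1, hence is ±1. The value 1 would make 2m a
    -- period, too short to cover the field.
    √-1 : ∀ {m} → q ≡ suc (m ℕ.* 4) → ∃[ i ] i ^ 2 ≈ - 1#
    √-1 {m} q≡1+m*4 with order
    ... | p , period , q≡2+p = β ^ m ,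
      [ ⊥-elim ∘ order∤m*2 m q≡1+m*4 m*4≡1+p , id ]′ (x*x≈1⇒x≈±1 (begin
        (β ^ m) ^ 2 * (β ^ m) ^ 2   ≈⟨ ^-homo-* (β ^ m) 2 2 ⟨
        (β ^ m) ^ 4                 ≈⟨ ^-assocʳ β m 4 ⟩
        β ^ (m ℕ.* 4)               ≈⟨ ^-congʳ β m*4≡1+p ⟩
        β ^ suc p                   ≈⟨ period ⟩
        1#                          ∎))
      where
      m*4≡1+p : m ℕ.* 4 ≡ suc p
      m*4≡1+p = ℕ.suc-injective (≡.trans (≡.sym q≡1+m*4) q≡2+p)
      order∤m*2 : ∀ m → q ≡ suc (m ℕ.* 4) → m ℕ.* 4 ≡ suc p → (β ^ m) ^ 2 ≉ 1#
      -- The equation `m ℕ.* 4 ≡ suc p` rules out m = 0, so 2m is a successor, as `period⇒q≤`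
      -- demands; it then gives q ≤ 2m + 1 < 4m + 1.
      order∤m*2 m@(suc m′) q≡1+m*4 _ eq =
        ℕ.<⇒≱ (s≤s (ℕ.*-monoʳ-< m (ℕ.m<m+n 2 {2} ℕ.z<s)))
          (≡.subst (_≤ suc (m ℕ.* 2)) q≡1+m*4
            (period⇒q≤ {suc (m′ ℕ.* 2)} (trans (sym (^-assocʳ β m 2)) eq)))

9^k≡1mod4 : ∀ k → ∃[ m ] 3 ℕ.^ (k ℕ.* 2) ≡ suc (m ℕ.* 4)
9^k≡1mod4 zero    = 0 , ≡.refl
9^k≡1mod4 (suc k) with 9^k≡1mod4 k
-- 9(1 + 4m) = 1 + 4(2 + 9m).
... | m , eq = 2 ℕ.+ 9 ℕ.* m ,
  ≡.trans (≡.cong (λ n → 3 ℕ.* (3 ℕ.* n)) eq) (identity m)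
  where
  identity : ∀ m → 3 ℕ.* (3 ℕ.* suc (m ℕ.* 4)) ≡ suc ((2 ℕ.+ 9 ℕ.* m) ℕ.* 4)
  identity = solve-∀

-- Fields of order 3^d: Frobenius and trace.

module FieldOfOrder3^d {c ℓ} (d : ℕ) (F : FiniteField c ℓ (3 ℕ.^ d)) where
  open FiniteField F
  open Trace d F
  open Curves F
  open FiniteFieldProperties F
  open RingProperties ring using (-0#≈0#; -‿involutive; x≈y⇒x∙y⁻¹≈ε)
  open Exp semiring using (^-congˡ; ^-congʳ; ^-homo-*; ^-assocʳ)
  open CommutativeExp commutativeSemiring using (^-distrib-*)
  open Mult semiring using (×1-homo-*)
  open Sum semiring using (sum; sum-init-last; sum-cong-≋)
  open SetoidReasoning setoid

  -- From 3^d · 1 = 0, factors 3 are split off one at a time in the absence of zero divisors;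
  -- running out of them would give 1 = 0.
  3·1≈0 : 3 · 1# ≈ 0#
  3·1≈0 = descend d q·1≈0
    where
    descend : ∀ n → (3 ℕ.^ n) · 1# ≈ 0# → 3 · 1# ≈ 0#
    descend zero    eq = ⊥-elim (1≉0 (trans (sym (+-identityʳ 1#)) eq))
    descend (suc n) eq =
      [ id , descend n ]′ (x*y≈0⇒x≈0∨y≈0 (trans (sym (×1-homo-* 3 (3 ℕ.^ n))) eq))

  1+1+1≈0 : 1# + (1# + 1#) ≈ 0#
  1+1+1≈0 = trans (+-congˡ (+-congˡ (sym (+-identityʳ 1#)))) 3·1≈0

  open CharacteristicThree commutativeRing 1+1+1≈0

  cube-+ : ∀ x y → (x + y) ^ 3 ≈ x ^ 3 + y ^ 3
  cube-+ = solve 2 (λ x y → (x :+ y) :^ 3 := x :^ 3 :+ y :^ 3) refl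

  Frob : ℕ → Carrier → Carrier
  Frob n x = x ^ (3 ℕ.^ n)

  Frob-suc : ∀ n x → Frob (suc n) x ≈ Frob n x ^ 3
  Frob-suc n x = trans (^-congʳ x (ℕ.*-comm 3 (3 ℕ.^ n))) (sym (^-assocʳ x (3 ℕ.^ n) 3))

  Frob-+ : ∀ n x y → Frob n (x + y) ≈ Frob n x + Frob n y
  Frob-+ zero    = solve 2 (λ x y → (x :+ y) :^ 1 := x :^ 1 :+ y :^ 1) refl
  Frob-+ (suc n) x y = begin
    Frob (suc n) (x + y)              ≈⟨ Frob-suc n _ ⟩
    Frob n (x + y) ^ 3                ≈⟨ ^-congˡ 3 (Frob-+ n x y) ⟩
    (Frob n x + Frob n y) ^ 3         ≈⟨ cube-+ _ _ ⟩
    Frob n x ^ 3 + Frob n y ^ 3       ≈⟨ +-cong (Frob-suc n x) (Frob-suc n y) ⟨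
    Frob (suc n) x + Frob (suc n) y   ∎

  -- The condition ε³ = ε expresses that ε lies in the prime subfield, over which the trace is
  -- linear.
  Frob-fixed : ∀ n {ε} → ε ^ 3 ≈ ε → Frob n ε ≈ ε
  Frob-fixed zero    ε³≈ε = *-identityʳ _
  Frob-fixed (suc n) ε³≈ε =
    trans (Frob-suc n _) (trans (^-congˡ 3 (Frob-fixed n ε³≈ε)) ε³≈ε)

  -- The length varies independently of `d`, which the type of the field fixes, so that trace
  -- identities can be proved by induction.
  partialTrace : ℕ → Carrier → Carrier
  partialTrace zero    x = 0#
  partialTrace (suc n) x = partialTrace n x + Frob n x

  partialTrace-sum : ∀ n x → sum {n} (λ i → Frob (toℕ i) x) ≈ partialTrace n x
  partialTrace-sum zero    x = refl
  partialTrace-sum (suc n) x = begin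
    sum {suc n} (λ i → Frob (toℕ i) x)
      -- `sum` unfolds at its first index, whereas `partialTrace` grows at its last.
      ≈⟨ sum-init-last {n} (λ i → Frob (toℕ i) x) ⟩
    sum {n} (λ i → Frob (toℕ (Fin.inject₁ i)) x) + Frob (toℕ (Fin.fromℕ n)) x
      ≈⟨ +-cong
           (trans (sum-cong-≋ {n} (λ i → reflexive (≡.cong (λ k → Frob k x) (Fin.toℕ-inject₁ i))))
                  (partialTrace-sum n x))
           (reflexive (≡.cong (λ k → Frob k x) (Fin.toℕ-fromℕ n))) ⟩
    partialTrace n x + Frob n x ∎

  Tr≈partialTrace : ∀ x → Tr x ≈ partialTrace d x
  Tr≈partialTrace = partialTrace-sum d

  partialTrace-cong : ∀ n {x y} → x ≈ y → partialTrace n x ≈ partialTrace n y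
  partialTrace-cong zero    x≈y = refl
  partialTrace-cong (suc n) x≈y =
    +-cong (partialTrace-cong n x≈y) (^-congˡ (3 ℕ.^ n) x≈y)

  partialTrace-+ : ∀ n x y → partialTrace n (x + y) ≈ partialTrace n x + partialTrace n y
  partialTrace-+ zero    x y = sym (+-identityˡ 0#)
  partialTrace-+ (suc n) x y = trans (+-cong (partialTrace-+ n x y) (Frob-+ n x y))
    (solve 4 (λ a b u v → (a :+ b) :+ (u :+ v) := (a :+ u) :+ (b :+ v)) refl _ _ _ _)

  partialTrace-* : ∀ n {ε} → ε ^ 3 ≈ ε → ∀ x → partialTrace n (ε * x) ≈ ε * partialTrace n x
  partialTrace-* zero    ε³≈ε x = sym (zeroʳ _)
  partialTrace-* (suc n) {ε} ε³≈ε x = begin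
    partialTrace n (ε * x) + Frob n (ε * x)
      ≈⟨ +-cong (partialTrace-* n ε³≈ε x) (^-distrib-* ε x (3 ℕ.^ n)) ⟩
    ε * partialTrace n x + Frob n ε * Frob n x
      ≈⟨ +-congˡ (*-congʳ (Frob-fixed n ε³≈ε)) ⟩
    ε * partialTrace n x + ε * Frob n x
      ≈⟨ distribˡ _ _ _ ⟨
    ε * (partialTrace n x + Frob n x) ∎

  -- Cubing shifts each conjugate one place: the n-th enters and x itself leaves.
  partialTrace-cube : ∀ n x → partialTrace n x ^ 3 ≈ partialTrace n x + Frob n x - x
  partialTrace-cube zero    = solve 1 (λ x → con 0₃ :^ 3 := con 0₃ :+ x :^ 1 :- x) refl
  partialTrace-cube (suc n) x = begin
    (t + f) ^ 3                ≈⟨ cube-+ t f ⟩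
    t ^ 3 + f ^ 3              ≈⟨ +-cong (partialTrace-cube n x) (sym (Frob-suc n x)) ⟩
    (t + f - x) + g            ≈⟨ solve 3 (λ a x g → (a :- x) :+ g := a :+ g :- x) refl _ _ _ ⟩
    (t + f) + g - x            ∎
    where
    t = partialTrace n x
    f = Frob n x
    g = Frob (suc n) x

  Tr-cong : ∀ {x y} → x ≈ y → Tr x ≈ Tr y
  Tr-cong {x} {y} x≈y =
    trans (Tr≈partialTrace x) (trans (partialTrace-cong d x≈y) (sym (Tr≈partialTrace y)))

  Tr-+ : ∀ x y → Tr (x + y) ≈ Tr x + Tr y
  Tr-+ x y = begin
    Tr (x + y)                          ≈⟨ Tr≈partialTrace _ ⟩
    partialTrace d (x + y)              ≈⟨ partialTrace-+ d x y ⟩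
    partialTrace d x + partialTrace d y ≈⟨ +-cong (Tr≈partialTrace x) (Tr≈partialTrace y) ⟨
    Tr x + Tr y                         ∎

  Tr-* : ∀ {ε} → ε ^ 3 ≈ ε → ∀ x → Tr (ε * x) ≈ ε * Tr x
  Tr-* {ε} ε³≈ε x = begin
    Tr (ε * x)               ≈⟨ Tr≈partialTrace _ ⟩
    partialTrace d (ε * x)   ≈⟨ partialTrace-* d ε³≈ε x ⟩
    ε * partialTrace d x     ≈⟨ *-congˡ (Tr≈partialTrace x) ⟨
    ε * Tr x                 ∎

  Tr-neg : ∀ x → Tr (- x) ≈ - Tr x
  Tr-neg x = begin
    Tr (- x)        ≈⟨ Tr-cong (solve 1 (λ x → :- x := con -1₃ :* x) refl x) ⟩
    Tr (- 1# * x)   ≈⟨ Tr-* (solve 0 (con -1₃ :^ 3 := con -1₃) refl) x ⟩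
    - 1# * Tr x     ≈⟨ solve 1 (λ x → con -1₃ :* x := :- x) refl _ ⟩
    - Tr x          ∎

  Tr-- : ∀ x y → Tr (x - y) ≈ Tr x - Tr y
  Tr-- x y = trans (Tr-+ x (- y)) (+-congˡ (Tr-neg y))

  ε²≈1⇒ε³≈ε : ∀ {ε} → ε * ε ≈ 1# → ε ^ 3 ≈ ε
  ε²≈1⇒ε³≈ε {ε} ε²≈1 = begin
    ε ^ 3         ≈⟨ solve 1 (λ e → e :^ 3 := e :* (e :* e)) refl ε ⟩
    ε * (ε * ε)   ≈⟨ *-congˡ ε²≈1 ⟩
    ε * 1#        ≈⟨ *-identityʳ ε ⟩
    ε             ∎

  module _ {β : Carrier} (prim : IsPrimitiveRoot β) where
    open PrimitiveRoot prim using (x^q≈x)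

    -- At n = d the entering conjugate x^q equals the leaving x, so traces lie in the prime
    -- subfield.
    Tr-cube : ∀ x → Tr x ^ 3 ≈ Tr x
    Tr-cube x = begin
      Tr x ^ 3                             ≈⟨ ^-congˡ 3 (Tr≈partialTrace x) ⟩
      partialTrace d x ^ 3                 ≈⟨ partialTrace-cube d x ⟩
      partialTrace d x + Frob d x - x      ≈⟨ +-congʳ (+-congˡ (x^q≈x x)) ⟩
      partialTrace d x + x - x             ≈⟨ solve 2 (λ t x → t :+ x :- x := t) refl _ x ⟩
      partialTrace d x                     ≈⟨ Tr≈partialTrace x ⟨
      Tr x                                 ∎

    -- By additivity of cubing Tr(ρ³) = (Tr ρ)³, and the latter is Tr ρ.
    Tr-Artin–Schreier : ∀ ρ → Tr (ρ ^ 3 - ρ) ≈ 0#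
    Tr-Artin–Schreier ρ = begin
      Tr (ρ ^ 3 - ρ)        ≈⟨ Tr-- _ _ ⟩
      Tr (ρ ^ 3) - Tr ρ     ≈⟨ x≈y⇒x∙y⁻¹≈ε (trans (cube-inside ρ) (Tr-cube ρ)) ⟩
      0#                    ∎
      where
      partialTrace-inside : ∀ n x → partialTrace n (x ^ 3) ≈ partialTrace n x ^ 3
      partialTrace-inside zero    x = solve 0 (con 0₃ := con 0₃ :^ 3) refl
      partialTrace-inside (suc n) x = trans
        (+-cong (partialTrace-inside n x)
          (trans (^-assocʳ x 3 (3 ℕ.^ n)) (Frob-suc n x)))
        (sym (cube-+ _ _))
      cube-inside : ∀ x → Tr (x ^ 3) ≈ Tr x ^ 3
      cube-inside x = trans (Tr≈partialTrace _)
        (trans (partialTrace-inside d x) (^-congˡ 3 (sym (Tr≈partialTrace x))))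

    Tr≉0⇒Tr²≈1 : ∀ x → Tr x ≉ 0# → Tr x * Tr x ≈ 1#
    Tr≉0⇒Tr²≈1 x Tr≉0 = *-cancelˡ-≉0 Tr≉0 (begin
      Tr x * (Tr x * Tr x)   ≈⟨ solve 1 (λ t → t :* (t :* t) := t :^ 3) refl _ ⟩
      Tr x ^ 3               ≈⟨ Tr-cube x ⟩
      Tr x                   ≈⟨ *-identityʳ _ ⟨
      Tr x * 1#              ∎)

    -- Additive Hilbert 90.

    module _ {α : Carrier} (Trα≈1 : Tr α ≈ 1#) where

      -- Hilbert's resolvent: at n = d its cube differs from it by −c.
      resolvent : ℕ → Carrier → Carrier
      resolvent zero    c = 0#
      resolvent (suc n) c = resolvent n c + partialTrace n c * Frob n α

      -- Write T_i for `partialTrace i`. Cubing turns T_i(c)·α^(3^i) into (T_{i+1}(c) -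
      -- c)·α^(3^(i+1)). The first parts sum to the next resolvent, since T_0 = 0; the others
      -- collect c times the shifted partial trace of α.
      resolvent-cube : ∀ n c → resolvent n c ^ 3 ≈
        resolvent n c + partialTrace n c * Frob n α - c * (partialTrace n α + Frob n α - α)
      resolvent-cube zero    = λ c → solve 2 (λ c a →
        con 0₃ :^ 3 := con 0₃ :+ con 0₃ :* a :^ 1 :- c :* (con 0₃ :+ a :^ 1 :- a)) refl c α
      resolvent-cube (suc n) c = begin
        (r + t * f) ^ 3
          ≈⟨ solve 3 (λ r t f → (r :+ t :* f) :^ 3 := r :^ 3 :+ t :^ 3 :* f :^ 3) refl r t f ⟩
        r ^ 3 + t ^ 3 * f ^ 3
          ≈⟨ +-cong (resolvent-cube n c) (*-cong (partialTrace-cube n c) (sym (Frob-suc n α))) ⟩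
        (r + t * f - c * (s + f - α)) + (t + Frob n c - c) * g
          ≈⟨ solve 8 (λ r t f c s a e g →
               (r :+ t :* f :- c :* (s :+ f :- a)) :+ (t :+ e :- c) :* g :=
               (r :+ t :* f) :+ (t :+ e) :* g :- c :* ((s :+ f) :+ g :- a))
             refl r t f c s α (Frob n c) g ⟩
        (r + t * f) + (t + Frob n c) * g - c * ((s + f) + g - α) ∎
        where
        r = resolvent n c
        t = partialTrace n c
        f = Frob n α
        g = Frob (suc n) α
        s = partialTrace n α

      -- At n = d the extra term carries the factor Tr c = 0, and c is multiplied by Tr α + α^q - α
      -- = 1. Hence r³ = r - c, and -r is the solution.
      hilbert90 : ∀ {c} → Tr c ≈ 0# → ∃[ ρ ] ρ ^ 3 - ρ ≈ c
      hilbert90 {c} Trc≈0 = - r , (begin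
        (- r) ^ 3 - (- r)
          ≈⟨ solve 1 (λ r → (:- r) :^ 3 :- (:- r) := r :- r :^ 3) refl r ⟩
        r - r ^ 3
          ≈⟨ +-congˡ (-‿cong (resolvent-cube d c)) ⟩
        r - (r + partialTrace d c * f - c * (partialTrace d α + f - α))
          ≈⟨ +-congˡ (-‿cong (+-cong
               (+-congˡ (*-congʳ (trans (sym (Tr≈partialTrace c)) Trc≈0)))
               (-‿cong (*-congˡ (+-congʳ (+-cong
                 (trans (sym (Tr≈partialTrace α)) Trα≈1) (x^q≈x α))))))) ⟩
        r - (r + 0# * f - c * (1# + α - α))
          ≈⟨ solve 4 (λ r f c a →
               r :- (r :+ con 0₃ :* f :- c :* (con 1₃ :+ a :- a)) := c) refl r f c α ⟩
        c ∎)
        where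
        r = resolvent d c
        f = Frob d α

  -- Isomorphisms of short Weierstrass curves

  record ShortIso (a₄ a₆ a₄′ a₆′ : Carrier) : Set (c ⊔ ℓ) where
    field
      u r   : Carrier
      u≉0   : u ≉ 0#
      a₄-eq : u ^ 4 * a₄′ ≈ a₄
      a₆-eq : u ^ 6 * a₆′ ≈ a₆ + r * a₄ + r ^ 3

  fromShortIso : ∀ {a₄ a₆ a₄′ a₆′} → ShortIso a₄ a₆ a₄′ a₆′ → short a₄ a₆ ≅ short a₄′ a₆′
  fromShortIso {a₄} {a₆} {a₄′} {a₆′} iso = record
    { u = u ; r = r ; s = 0# ; t = 0# ; u≉0 = u≉0
    ; a₁-eq = solve 1 (λ u → u :* con 0₃ := con 0₃ :+ 2 :× con 0₃) refl u
    ; a₂-eq = solve 2 (λ u r → u :^ 2 :* con 0₃ :=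
        con 0₃ :- con 0₃ :* con 0₃ :+ 3 :× r :- con 0₃ :^ 2) refl u r
    ; a₃-eq = solve 2 (λ u r → u :^ 3 :* con 0₃ :=
        con 0₃ :+ r :* con 0₃ :+ 2 :× con 0₃) refl u r
    ; a₄-eq = trans a₄-eq (solve 2 (λ a r → a :=
        a :- con 0₃ :* con 0₃ :+ 2 :× (r :* con 0₃) :- (con 0₃ :+ r :* con 0₃) :* con 0₃
          :+ 3 :× (r :^ 2) :- 2 :× (con 0₃ :* con 0₃)) refl a₄ r)
    ; a₆-eq = trans a₆-eq (solve 3 (λ a b r → b :+ r :* a :+ r :^ 3 :=
        b :+ r :* a :+ r :^ 2 :* con 0₃ :+ r :^ 3
          :- con 0₃ :* con 0₃ :- con 0₃ :^ 2 :- r :* con 0₃ :* con 0₃) refl a₄ a₆ r)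
    }
    where open ShortIso iso

  -- Since 2 = -1, the a₁ and a₃ equations force s = t = 0; the terms 3r and 3r² vanish in
  -- characteristic 3.
  toShortIso : ∀ {a₄ a₆ a₄′ a₆′} → short a₄ a₆ ≅ short a₄′ a₆′ → ShortIso a₄ a₆ a₄′ a₆′
  toShortIso {a₄} {a₆} {a₄′} {a₆′} iso = record
    { u = u ; r = r ; u≉0 = u≉0
    ; a₄-eq = begin
        u ^ 4 * a₄′
          ≈⟨ I.a₄-eq ⟩
        _
          ≈⟨ solve 4 (λ a r s t →
               a :- s :* con 0₃ :+ 2 :× (r :* con 0₃) :- (t :+ r :* s) :* con 0₃
                 :+ 3 :× (r :^ 2) :- 2 :× (s :* t) := a :+ s :* t) refl a₄ r s t ⟩
        a₄ + s * t
          ≈⟨ +-congˡ (*-congʳ s≈0) ⟩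
        a₄ + 0# * t
          ≈⟨ solve 2 (λ a t → a :+ con 0₃ :* t := a) refl a₄ t ⟩
        a₄ ∎
    ; a₆-eq = begin
        u ^ 6 * a₆′
          ≈⟨ I.a₆-eq ⟩
        _
          ≈⟨ solve 4 (λ a b r t →
               b :+ r :* a :+ r :^ 2 :* con 0₃ :+ r :^ 3
                 :- t :* con 0₃ :- t :^ 2 :- r :* t :* con 0₃ :=
               b :+ r :* a :+ r :^ 3 :- t :* t) refl a₄ a₆ r t ⟩
        a₆ + r * a₄ + r ^ 3 - t * t
          ≈⟨ +-congˡ (-‿cong (*-congʳ t≈0)) ⟩
        a₆ + r * a₄ + r ^ 3 - 0# * t
          ≈⟨ solve 2 (λ w t → w :- con 0₃ :* t := w) refl _ t ⟩
        a₆ + r * a₄ + r ^ 3 ∎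
    }
    where
    module I = _≅_ iso
    open I using (u; r; s; t; u≉0)
    s≈0 : s ≈ 0#
    s≈0 = begin
      s                  ≈⟨ solve 1 (λ s → s := :- (con 0₃ :+ 2 :× s)) refl s ⟩
      - (0# + 2 · s)     ≈⟨ -‿cong I.a₁-eq ⟨
      - (u * 0#)         ≈⟨ solve 1 (λ u → :- (u :* con 0₃) := con 0₃) refl u ⟩
      0#                 ∎
    t≈0 : t ≈ 0#
    t≈0 = begin
      t                           ≈⟨ solve 2 (λ r t → t := :- (con 0₃ :+ r :* con 0₃ :+ 2 :× t)) refl r t ⟩
      - (0# + r * 0# + 2 · t)     ≈⟨ -‿cong I.a₃-eq ⟨
      - (u ^ 3 * 0#)              ≈⟨ solve 1 (λ u → :- (u :^ 3 :* con 0₃) := con 0₃) refl u ⟩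
      0#                          ∎

  -- Here b₂ = 0 and 27 = 0, which leaves -8(2a₄)³ = -64a₄³ with 64 = 1 in characteristic 3.
  Δ-short : ∀ a₄ a₆ → WeierstrassCurve.Δ (short a₄ a₆) ≈ - (a₄ ^ 3)
  Δ-short = solve 2 (λ a b →
    let b₂ = con 0₃ :^ 2 :+ 4 :× con 0₃
        b₄ = 2 :× a :+ con 0₃ :* con 0₃
        b₆ = con 0₃ :^ 2 :+ 4 :× b
        b₈ = con 0₃ :^ 2 :* b :+ 4 :× (con 0₃ :* b) :- con 0₃ :* con 0₃ :* a
               :+ con 0₃ :* con 0₃ :^ 2 :- a :^ 2
    in 9 :× (b₂ :* b₄ :* b₆) :- b₂ :^ 2 :* b₈ :- 8 :× (b₄ :^ 3) :- 27 :× (b₆ :^ 2)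
       := :- (a :^ 3)) refl

  -- An isomorphism scales a₄ by a fourth power, which changes neither its class modulo squares nor
  -- that modulo fourth powers.
  isTypeII-resp-≅ : ∀ {a₄ a₆ a₄′ a₆′} → short a₄′ a₆′ ≅ short a₄ a₆ →
                    IsTypeII a₄ → IsTypeII a₄′
  isTypeII-resp-≅ {a₄} {a₄′ = a₄′} iso II = record
    { nonZero = λ -a₄′≈0 → *-≉0 (^-≉0 4 u≉0) II.nonZero (trans u⁴-a₄≈-a₄′ -a₄′≈0)
    ; square  = let v , v≉0 , v²≈-a₄ = II.square in
        u ^ 2 * v , *-≉0 (^-≉0 2 u≉0) v≉0 , (begin
          (u ^ 2 * v) ^ 2    ≈⟨ solve 2 (λ u v → (u :^ 2 :* v) :^ 2 := u :^ 4 :* v :^ 2) refl u v ⟩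
          u ^ 4 * v ^ 2      ≈⟨ *-congˡ v²≈-a₄ ⟩
          u ^ 4 * (- a₄)     ≈⟨ u⁴-a₄≈-a₄′ ⟩
          - a₄′              ∎)
    ; notFourthPower = λ (w , w≉0 , w⁴≈-a₄′) → II.notFourthPower
        (u⁻¹ * w , *-≉0 (inv-≉0 u≉0) w≉0 , (begin
          (u⁻¹ * w) ^ 4              ≈⟨ ^-distrib-* u⁻¹ w 4 ⟩
          u⁻¹ ^ 4 * w ^ 4            ≈⟨ *-congˡ (trans w⁴≈-a₄′ (sym u⁴-a₄≈-a₄′)) ⟩
          u⁻¹ ^ 4 * (u ^ 4 * - a₄)   ≈⟨ solve 3 (λ v u a → v :^ 4 :* (u :^ 4 :* a) :=
                                          (u :* v) :^ 4 :* a) refl u⁻¹ u (- a₄) ⟩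
          (u * u⁻¹) ^ 4 * - a₄       ≈⟨ *-congʳ (trans (^-congˡ 4 (proj₂ (inverse u≉0))) (1^n≈1 4)) ⟩
          1# * - a₄                  ≈⟨ *-identityˡ _ ⟩
          - a₄                       ∎))
    }
    where
    module II = IsTypeII II
    open ShortIso (toShortIso iso)
    u⁻¹ = inv u≉0
    u⁴-a₄≈-a₄′ : u ^ 4 * (- a₄) ≈ - a₄′
    u⁴-a₄≈-a₄′ = trans (solve 2 (λ u a → u :^ 4 :* (:- a) := :- (u :^ 4 :* a)) refl u a₄)
      (-‿cong a₄-eq)

  -- The family E_b: normal form and isomorphism criterion.

  module Family {β : Carrier} (prim : IsPrimitiveRoot β) where
    open IsPrimitiveRoot prim using (nonZero; generates)

    E : Carrier → WeierstrassCurve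
    E b = short (- (β ^ 2)) b

    γ : Carrier
    γ = inv nonZero

    -- The solver treats β and γ as independent variables, so inverses are cancelled by collecting
    -- powers of `β * γ` and rewriting them with this.
    [βγ]^n≈1 : ∀ n → (β * γ) ^ n ≈ 1#
    [βγ]^n≈1 n = trans (^-congˡ n (proj₂ (inverse nonZero))) (1^n≈1 n)

    E-elliptic : ∀ b → IsElliptic (E b)
    E-elliptic b Δ≈0 = ^-≉0 6 nonZero (begin
      β ^ 6                          ≈⟨ solve 1 (λ β → β :^ 6 := :- ((:- (β :^ 2)) :^ 3)) refl β ⟩
      - ((- (β ^ 2)) ^ 3)            ≈⟨ Δ-short _ b ⟨
      WeierstrassCurve.Δ (E b)       ≈⟨ Δ≈0 ⟩
      0#                             ∎)

    -- A non-fourth-power square is the square of an odd power β^(1+2k); the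
    -- isomorphism rescales by β^k.
    typeII-normalForm : ∀ a₄ a₆ (II : IsTypeII a₄) →
      ∃[ u ] ( u ≉ 0#
             × u ^ 4 ≈ β ^ 2 * inv (IsTypeII.nonZero II)
             × short a₄ a₆ ≅ E (u ^ 6 * a₆) )
    typeII-normalForm a₄ a₆ II with IsTypeII.square II
    ... | v , v≉0 , v²≈-a₄ with generates v v≉0
    ... | n , βⁿ≈v with n divMod 2
    -- An even exponent would make -a₄ = (β^k)⁴.
    ... | result k 0F ≡.refl = ⊥-elim (IsTypeII.notFourthPower II
      (β ^ k , ^-≉0 k nonZero , (begin
        (β ^ k) ^ 4           ≈⟨ solve 1 (λ w → w :^ 4 := (w :^ 2) :^ 2) refl _ ⟩
        ((β ^ k) ^ 2) ^ 2     ≈⟨ ^-congˡ 2 (^-assocʳ β k 2) ⟩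
        (β ^ (k ℕ.* 2)) ^ 2   ≈⟨ ^-congˡ 2 βⁿ≈v ⟩
        v ^ 2                 ≈⟨ v²≈-a₄ ⟩
        - a₄                  ∎)))
    -- Now -a₄ = β²w⁴ with w = β^k. The fields of `_≅_` scale the target's coefficients, so the
    -- substitution uses w while the u of the statement is its inverse.
    ... | result k 1F ≡.refl = w⁻¹ , inv-≉0 w≉0 , w⁻⁴≈ , fromShortIso (record
      { u = w ; r = 0# ; u≉0 = w≉0
      ; a₄-eq = begin
          w ^ 4 * - (β ^ 2)    ≈⟨ solve 2 (λ w β → w :^ 4 :* (:- (β :^ 2)) := :- (β :^ 2 :* w :^ 4)) refl w β ⟩
          - (β ^ 2 * w ^ 4)    ≈⟨ -‿cong -a₄≈β²w⁴ ⟨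
          - (- a₄)             ≈⟨ -‿involutive a₄ ⟩
          a₄                   ∎
      ; a₆-eq = begin
          w ^ 6 * (w⁻¹ ^ 6 * a₆)   ≈⟨ solve 3 (λ w v a → w :^ 6 :* (v :^ 6 :* a) := (w :* v) :^ 6 :* a)
                                        refl w w⁻¹ a₆ ⟩
          (w * w⁻¹) ^ 6 * a₆       ≈⟨ *-congʳ (ww⁻¹^n≈1 6) ⟩
          1# * a₆                  ≈⟨ solve 2 (λ a b → con 1₃ :* b := b :+ con 0₃ :* a :+ con 0₃ :^ 3)
                                        refl a₄ a₆ ⟩
          a₆ + 0# * a₄ + 0# ^ 3    ∎
      })
      where
      w = β ^ k
      w≉0 = ^-≉0 k nonZero
      w⁻¹ = inv w≉0
      j = inv (IsTypeII.nonZero II)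
      ww⁻¹^n≈1 : ∀ n → (w * w⁻¹) ^ n ≈ 1#
      ww⁻¹^n≈1 n = trans (^-congˡ n (proj₂ (inverse w≉0))) (1^n≈1 n)
      -a₄≈β²w⁴ : - a₄ ≈ β ^ 2 * w ^ 4
      -a₄≈β²w⁴ = begin
        - a₄                        ≈⟨ v²≈-a₄ ⟨
        v ^ 2                       ≈⟨ ^-congˡ 2 βⁿ≈v ⟨
        (β * β ^ (k ℕ.* 2)) ^ 2     ≈⟨ ^-congˡ 2 (*-congˡ (^-assocʳ β k 2)) ⟨
        (β * w ^ 2) ^ 2             ≈⟨ solve 2 (λ β w → (β :* w :^ 2) :^ 2 := β :^ 2 :* w :^ 4) refl β w ⟩
        β ^ 2 * w ^ 4               ∎
      w⁻⁴≈ : w⁻¹ ^ 4 ≈ β ^ 2 * j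
      w⁻⁴≈ = begin
        w⁻¹ ^ 4                          ≈⟨ *-identityˡ _ ⟨
        1# * w⁻¹ ^ 4                     ≈⟨ *-congʳ (proj₂ (inverse (IsTypeII.nonZero II))) ⟨
        - a₄ * j * w⁻¹ ^ 4               ≈⟨ *-congʳ (*-congʳ -a₄≈β²w⁴) ⟩
        β ^ 2 * w ^ 4 * j * w⁻¹ ^ 4      ≈⟨ solve 4 (λ β w j v → β :^ 2 :* w :^ 4 :* j :* v :^ 4 :=
                                              β :^ 2 :* j :* (w :* v) :^ 4) refl β w j w⁻¹ ⟩
        β ^ 2 * j * (w * w⁻¹) ^ 4        ≈⟨ *-congˡ (ww⁻¹^n≈1 4) ⟩
        β ^ 2 * j * 1#                   ≈⟨ *-identityʳ _ ⟩
        β ^ 2 * j                        ∎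

    -- For r = βρ the terms r·a₄ + r³ become β³(ρ³ - ρ), so multiplying the hypothesis by β³ gives
    -- the a₆ equation.
    twist⇒≅ : ∀ {b b′ u ρ} → u ^ 2 * u ^ 2 ≈ 1# →
              u ^ 2 * (b′ * γ ^ 3) ≈ b * γ ^ 3 + (ρ ^ 3 - ρ) → E b ≅ E b′
    twist⇒≅ {b} {b′} {u} {ρ} u⁴≈1 eq = fromShortIso (record
      { u = u ; r = β * ρ
      ; u≉0 = λ u≈0 → 1≉0 (trans (sym u⁴≈1)
          (trans (*-congʳ (^-congˡ 2 u≈0)) (solve 1 (λ u → con 0₃ :^ 2 :* u := con 0₃) refl _)))
      ; a₄-eq = begin
          u ^ 4 * - (β ^ 2)              ≈⟨ *-congʳ (^-homo-* u 2 2) ⟩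
          u ^ 2 * u ^ 2 * - (β ^ 2)      ≈⟨ *-congʳ u⁴≈1 ⟩
          1# * - (β ^ 2)                 ≈⟨ *-identityˡ _ ⟩
          - (β ^ 2)                      ∎
      ; a₆-eq = begin
          u ^ 6 * b′
            -- u⁶ is split as u⁴·u², and the inserted factor 1 is about to become (βγ)³.
            ≈⟨ solve 2 (λ u b → u :^ 6 :* b := u :^ 2 :* u :^ 2 :* (u :^ 2 :* b :* con 1₃)) refl u b′ ⟩
          u ^ 2 * u ^ 2 * (u ^ 2 * b′ * 1#)
            ≈⟨ *-cong u⁴≈1 (*-congˡ (sym ([βγ]^n≈1 3))) ⟩
          1# * (u ^ 2 * b′ * (β * γ) ^ 3)
            ≈⟨ solve 4 (λ v b β γ → con 1₃ :* (v :* b :* (β :* γ) :^ 3) :=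
                 β :^ 3 :* (v :* (b :* γ :^ 3))) refl (u ^ 2) b′ β γ ⟩
          β ^ 3 * (u ^ 2 * (b′ * γ ^ 3))
            ≈⟨ *-congˡ eq ⟩
          β ^ 3 * (b * γ ^ 3 + (ρ ^ 3 - ρ))
            ≈⟨ solve 4 (λ b β γ ρ → β :^ 3 :* (b :* γ :^ 3 :+ (ρ :^ 3 :- ρ)) :=
                 b :* (β :* γ) :^ 3 :+ β :* ρ :* (:- (β :^ 2)) :+ (β :* ρ) :^ 3) refl b β γ ρ ⟩
          b * (β * γ) ^ 3 + β * ρ * - (β ^ 2) + (β * ρ) ^ 3
            ≈⟨ +-congʳ (+-congʳ (trans (*-congˡ ([βγ]^n≈1 3)) (*-identityʳ b))) ⟩
          b + β * ρ * - (β ^ 2) + (β * ρ) ^ 3 ∎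
      })

    -- The substitution r = βρ is inverted by ρ = rγ; cancelling β² in the a₄ equation gives u⁴ = 1.
    ≅⇒twist : ∀ {b b′} → E b ≅ E b′ →
              ∃[ u ] ∃[ ρ ] ( u ^ 2 * u ^ 2 ≈ 1#
                            × u ^ 2 * (b′ * γ ^ 3) ≈ b * γ ^ 3 + (ρ ^ 3 - ρ) )
    ≅⇒twist {b} {b′} iso = u , r * γ , u⁴≈1 , (begin
      u ^ 2 * (b′ * γ ^ 3)
        ≈⟨ *-identityˡ _ ⟨
      1# * (u ^ 2 * (b′ * γ ^ 3))
        ≈⟨ *-congʳ u⁴≈1 ⟨
      u ^ 2 * u ^ 2 * (u ^ 2 * (b′ * γ ^ 3))
        ≈⟨ solve 3 (λ u b γ → u :^ 2 :* u :^ 2 :* (u :^ 2 :* (b :* γ :^ 3)) := u :^ 6 :* b :* γ :^ 3)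
             refl u b′ γ ⟩
      u ^ 6 * b′ * γ ^ 3
        ≈⟨ *-congʳ a₆-eq ⟩
      (b + r * - (β ^ 2) + r ^ 3) * γ ^ 3
        ≈⟨ solve 4 (λ b r β γ → (b :+ r :* (:- (β :^ 2)) :+ r :^ 3) :* γ :^ 3 :=
             b :* γ :^ 3 :+ ((r :* γ) :^ 3 :- (r :* γ) :* (β :* γ) :^ 2)) refl b r β γ ⟩
      b * γ ^ 3 + ((r * γ) ^ 3 - r * γ * (β * γ) ^ 2)
        ≈⟨ +-congˡ (+-congˡ (-‿cong (trans (*-congˡ ([βγ]^n≈1 2)) (*-identityʳ _)))) ⟩
      b * γ ^ 3 + ((r * γ) ^ 3 - r * γ) ∎)
      where
      open ShortIso (toShortIso iso)
      u⁴≈1 : u ^ 2 * u ^ 2 ≈ 1#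
      u⁴≈1 = *-cancelˡ-≉0 (^-≉0 2 nonZero) (begin
        β ^ 2 * (u ^ 2 * u ^ 2)    ≈⟨ solve 2 (λ β u → β :^ 2 :* (u :^ 2 :* u :^ 2) :=
                                        :- (u :^ 4 :* (:- (β :^ 2)))) refl β u ⟩
        - (u ^ 4 * - (β ^ 2))      ≈⟨ -‿cong a₄-eq ⟩
        - (- (β ^ 2))              ≈⟨ solve 1 (λ β → :- (:- (β :^ 2)) := β :^ 2 :* con 1₃) refl β ⟩
        β ^ 2 * 1#                 ∎)

    -- The two isomorphism classes, separated by the trace.

    module Classes {α : Carrier} (Trα≈1 : Tr α ≈ 1#) where

      αβ³γ³≈α : α * β ^ 3 * γ ^ 3 ≈ α
      αβ³γ³≈α = begin
        α * β ^ 3 * γ ^ 3    ≈⟨ solve 3 (λ α β γ → α :* β :^ 3 :* γ :^ 3 := α :* (β :* γ) :^ 3)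
                                  refl α β γ ⟩
        α * (β * γ) ^ 3      ≈⟨ *-congˡ ([βγ]^n≈1 3) ⟩
        α * 1#               ≈⟨ *-identityʳ α ⟩
        α                    ∎

      -- With u = 1 and b′ = 0 the criterion asks for ρ³ - ρ = -bβ⁻³, whose trace is zero.
      Tr≈0⇒≅E₀ : ∀ b → Tr (b * γ ^ 3) ≈ 0# → E b ≅ E 0#
      Tr≈0⇒≅E₀ b Tr≈0 =
        let ρ , ρ³-ρ≈-bγ³ = hilbert90 prim Trα≈1
              (trans (Tr-neg (b * γ ^ 3)) (trans (-‿cong Tr≈0) -0#≈0#))
        in twist⇒≅ {u = 1#} {ρ = ρ} (solve 0 (con 1₃ :^ 2 :* con 1₃ :^ 2 := con 1₃) refl) (begin
          1# ^ 2 * (0# * γ ^ 3)          ≈⟨ solve 2 (λ γ c → con 1₃ :^ 2 :* (con 0₃ :* γ :^ 3) :=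
                                              c :+ (:- c)) refl γ _ ⟩
          b * γ ^ 3 + - (b * γ ^ 3)      ≈⟨ +-congˡ ρ³-ρ≈-bγ³ ⟨
          b * γ ^ 3 + (ρ ^ 3 - ρ)        ∎)

      -- The trace τ of bβ⁻³ is ±1, hence some u². Then τα and bβ⁻³ have equal traces, and Hilbert
      -- 90 applies to their difference.
      Tr≉0⇒≅E₁ : (∃[ i ] i ^ 2 ≈ - 1#) →
                 ∀ b → Tr (b * γ ^ 3) ≉ 0# → E b ≅ E (α * β ^ 3)
      Tr≉0⇒≅E₁ (i , i²≈-1) b Tr≉0 =
        let u , u²≈τ = √τ
            ρ , ρ³-ρ≈τα-c = hilbert90 prim Trα≈1 Tr[τα-c]≈0
        in twist⇒≅ {u = u} {ρ = ρ} (trans (*-cong u²≈τ u²≈τ) τ²≈1) (begin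
          u ^ 2 * (α * β ^ 3 * γ ^ 3)    ≈⟨ *-cong u²≈τ αβ³γ³≈α ⟩
          τ * α                          ≈⟨ solve 2 (λ x c → x := c :+ (x :- c)) refl _ c′ ⟩
          c′ + (τ * α - c′)              ≈⟨ +-congˡ ρ³-ρ≈τα-c ⟨
          c′ + (ρ ^ 3 - ρ)               ∎)
        where
        c′ = b * γ ^ 3
        τ = Tr c′
        τ²≈1 : τ * τ ≈ 1#
        τ²≈1 = Tr≉0⇒Tr²≈1 prim c′ Tr≉0
        √τ : ∃[ u ] u ^ 2 ≈ τ
        √τ = [ (λ τ≈1  → 1# , trans (1^n≈1 2) (sym τ≈1))
             , (λ τ≈-1 → i , trans i²≈-1 (sym τ≈-1)) ]′ (x*x≈1⇒x≈±1 τ²≈1)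
        Tr[τα-c]≈0 : Tr (τ * α - c′) ≈ 0#
        Tr[τα-c]≈0 = begin
          Tr (τ * α - c′)      ≈⟨ Tr-- _ _ ⟩
          Tr (τ * α) - τ       ≈⟨ +-congʳ (Tr-* (ε²≈1⇒ε³≈ε τ²≈1) α) ⟩
          τ * Tr α - τ         ≈⟨ +-congʳ (trans (*-congˡ Trα≈1) (*-identityʳ τ)) ⟩
          τ - τ                ≈⟨ -‿inverseʳ τ ⟩
          0#                   ∎

      -- An isomorphism would give u²α = ρ³ - ρ with u² in the prime subfield; taking traces yields
      -- u² = 0, against u⁴ = 1.
      E₀≇E₁ : ¬ (E 0# ≅ E (α * β ^ 3))
      E₀≇E₁ iso =
        let u , ρ , u⁴≈1 , eq = ≅⇒twist iso
            u²≈0 : u ^ 2 ≈ 0#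
            u²≈0 = begin
              u ^ 2                                 ≈⟨ *-identityʳ _ ⟨
              u ^ 2 * 1#                            ≈⟨ *-congˡ Trα≈1 ⟨
              u ^ 2 * Tr α                          ≈⟨ Tr-* (ε²≈1⇒ε³≈ε u⁴≈1) α ⟨
              Tr (u ^ 2 * α)                        ≈⟨ Tr-cong (*-congˡ αβ³γ³≈α) ⟨
              Tr (u ^ 2 * (α * β ^ 3 * γ ^ 3))      ≈⟨ Tr-cong eq ⟩
              Tr (0# * γ ^ 3 + (ρ ^ 3 - ρ))         ≈⟨ Tr-cong (trans (+-congʳ (zeroˡ _)) (+-identityˡ _)) ⟩
              Tr (ρ ^ 3 - ρ)                        ≈⟨ Tr-Artin–Schreier prim ρ ⟩
              0#                                    ∎
        in 1≉0 (trans (sym u⁴≈1) (trans (*-congˡ u²≈0) (zeroʳ _)))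

mainTheorem3 :
  ∀ {c ℓ} (d : ℕ) → 2 ∣ d → (F : FiniteField c ℓ (3 ℕ.^ d)) →
  let open FiniteField F
      open Trace d F
      open Curves F
  in
  (β : Carrier) (β-prim : IsPrimitiveRoot β) (α : Carrier) → Tr α ≈ 1# →
  let β⁻³ = inv (IsPrimitiveRoot.nonZero β-prim) ^ 3
      E   = λ (b : Carrier) → short (- (β ^ 2)) b
  in
  ( (a₄ a₆ : Carrier) → IsElliptic (short a₄ a₆) → (II : IsTypeII a₄) →
      ( ∃[ u ] ( u ≉ 0#
               × u ^ 4 ≈ β ^ 2 * inv (IsTypeII.nonZero II)
               × short a₄ a₆ ≅ E (u ^ 6 * a₆) ) )
    × ( (a₄′ a₆′ : Carrier) → IsElliptic (short a₄′ a₆′) →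
          short a₄′ a₆′ ≅ short a₄ a₆ → IsTypeII a₄′ ) )
  × ( (b : Carrier) → IsElliptic (E b) )
  × ExactlyTwoClasses _≅_ E
  × ( (b : Carrier) → Tr (b * β⁻³) ≈ 0# → E b ≅ E 0# )
  × ( (b : Carrier) → Tr (b * β⁻³) ≉ 0# → E b ≅ E (α * β ^ 3) )
mainTheorem3 d (divides k d≡k*2) F β β-prim α Trα≈1 =
    (λ a₄ a₆ _ II → typeII-normalForm a₄ a₆ II , λ _ _ _ iso → isTypeII-resp-≅ iso II)
  , E-elliptic
  , ( 0# , α * β ^ 3 , E₀≇E₁
    , λ b → case-Tr b (Tr (b * γ ^ 3) ≟ 0#) )
  , Tr≈0⇒≅E₀
  , Tr≉0⇒≅E₁ i
  where
  open FiniteField F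
  open Trace d F
  open Curves F
  open FiniteFieldProperties F
  open FieldOfOrder3^d d F
  open Family β-prim
  open Classes Trα≈1
  i : ∃[ i ] i ^ 2 ≈ - 1#
  i = let m , 9^k≡1+m*4 = 9^k≡1mod4 k in
      PrimitiveRoot.√-1 β-prim {m} (≡.trans (≡.cong (3 ℕ.^_) d≡k*2) 9^k≡1+m*4)
  case-Tr : ∀ b → Dec (Tr (b * γ ^ 3) ≈ 0#) → E b ≅ E 0# ⊎ E b ≅ E (α * β ^ 3)
  case-Tr b (yes Tr≈0) = inj₁ (Tr≈0⇒≅E₀ b Tr≈0)
  case-Tr b (no  Tr≉0) = inj₂ (Tr≉0⇒≅E₁ i b Tr≉0)
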